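{- Let $n\ge1$. If $H$ is dense in $\widehat{\mathcal F_n}$, then $X\in H$ is $\sqcup$-irreducible (as an element of the lattice $H$) if and only if for all (incomparable) $w_0,w_1\in X$ there exists an element $w\in X$ with $w\geqslant w_0$ and $w\geqslant w_1$, i.e. $X$ as a subset of $(K_n,\le)$ is upward filtering.
   Context: Fix $n\ge1$ and symbols $P_1,\dots,P_n$. The partially ordered set $(K_n,\le)$ with valuation map $\mathrm{val}:K_n\to\mathfrak P(\{P_1,\dots,P_n\})$ is the increasing union of finite sets $K_n^d$ ($d\ge 0$) built recursively: $K_n^{ -1}=\emptyset$, and $K_n^d\setminus K_n^{d-1}$ consists of exactly one point $w_{\beta,Y}$ for each pair $(\beta,Y)$ such that (i) $Y$ is a decreasing subset of $K_n^{d-1}$ with $Y\not\subseteq K_n^{d-2}$ (for $d=0$ this last condition is void, so $Y=\emptyset$); (ii) $\beta\subseteq\{P_1,\dots,P_n\}$ and $\beta\subseteq\mathrm{val}(w')$ for all $w'\in Y$; (iii) if $Y$ is the decreasing set generated by a single element $w_{\beta',Y'}$, then $\beta\ne\beta'$. One sets $\mathrm{val}(w_{\beta,Y})=\beta$, and $w\le w_{\beta,Y}$ iff $w\in Y$ or $w=w_{\beta,Y}$. $\widehat{\mathcal F_n}:=\mathcal O_\downarrow(K_n,\le)$ is the Heyting algebra of all decreasing subsets of $K_n$ ($\sqcap=\cap$, $\sqcup=\cup$, $a\to b$ = the largest decreasing set contained in $(K_n\setminus a)\cup b$). It carries the metric $\mathrm d(a,b)=2^{ -\min\{i\in\mathbb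 N\mid a\cap K_n^i\neq b\cap K_n^i\}}$ ($2^{ -\min\emptyset}=0$). "$H$ is dense in $\widehat{\mathcal F_n}$" means that $H$ is a Heyting sub-algebra of $\widehat{\mathcal F_n}$ that is dense for this metric. An element $a$ of a lattice is $\sqcup$-irreducible if it is different from $0$ and cannot be written as $b_1\sqcup b_2$ with $b_1\neq a$ and $b_2\ne a$.
   Formalization: "Upward filtering" is taken to include that X is nonempty: the empty set, which is 0 in H, satisfies the pairwise condition vacuously but is not ⊔-irreducible, so the literal equivalence fails for X = ∅ only. -}

module Defs where

open import Axiom.ExcludedMiddle using (ExcludedMiddle)
open import Data.Empty using (⊥; ⊥-elim)
import Data.Fin.Subset as Sub
open import Data.Integer.Base using (+_)
open import Data.List.Base using (List; []; _∷_)
open import Data.List.Relation.Unary.All using (All; []; _∷_)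
open import Data.List.Relation.Unary.Any as Any using (Any; here; there)
open import Data.Nat.Base as ℕ using (ℕ; zero; suc)
open import Data.Nat.Properties using (m^n≢0)
open import Data.Product.Base using (Σ; ∃; ∃₂; _×_; _,_; proj₁; proj₂)
open import Data.Rational.Base as ℚ using (ℚ; 0ℚ; _/_)
open import Data.Sum.Base using (_⊎_; inj₁; inj₂; [_,_]′)
open import Data.Unit.Base using (⊤; tt)
open import Level using (Level; 0ℓ; _⊔_) renaming (suc to lsuc)
open import Relation.Binary.Bundles using (Poset)
open import Relation.Binary.Lattice.Bundles using (BoundedLattice; HeytingAlgebra)
open import Relation.Binary.PropositionalEquality using (_≡_; _≢_; refl)
open import Relation.Nullary using (¬_; Dec; yes; no)
open import Relation.Unary using (Pred; _⊆_; _≐_; _∩_; _∪_; ∁; ∅; U)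

-- Codes for the points: node β Y is w_{β,Y}, the finite set Y being given by
-- a list.  Lists with the same elements denote the same set, so points are
-- compared with _≈_ and not with _≡_.
data Point (n : ℕ) : Set where
  node : Sub.Subset n → List (Point n) → Point n

val : ∀ {n} → Point n → Sub.Subset n
val (node β Y) = β

strict : ∀ {n} → Point n → List (Point n)
strict (node β Y) = Y

module _ {n : ℕ} where

  infix 4 _≈_ _≤_

  data _≈_ : Point n → Point n → Set where
    node : ∀ {β Y Z} →
           All (λ y → Any (λ z → y ≈ z) Z) Y →
           All (λ z → Any (λ y → y ≈ z) Y) Z →
           node β Y ≈ node β Z

  ⟦_⟧ : List (Point n) → Pred (Point n) 0ℓ
  ⟦ Y ⟧ w = Any (w ≈_) Y

  _≤_ : Point n → Point n → Set
  w ≤ v = ⟦ strict v ⟧ w ⊎ w ≈ v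

  -- The conditions on (β , Y) for w_{β,Y} to be a point of K_n^d, apart from
  -- Y ⊈ K_n^{d-2}; S plays the role of K_n^{d-1}.
  record Admissible (S : Pred (Point n) 0ℓ) (β : Sub.Subset n)
                    (Y : List (Point n)) : Set where
    field
      subset       : ⟦ Y ⟧ ⊆ S
      decreasing   : ∀ {v w} → S v → v ≤ w → ⟦ Y ⟧ w → ⟦ Y ⟧ v
      val-bound    : ∀ {w} → ⟦ Y ⟧ w → β Sub.⊆ val w
      val-distinct : ∀ {w} → S w → ⟦ Y ⟧ ≐ (λ v → S v × v ≤ w) → β ≢ val w

  -- The index is shifted: Below d is K_n^{d-1}, so that Below 0 is empty.
  mutual
    Below : ℕ → Pred (Point n) 0ℓ
    Below zero    w          = ⊥
    Below (suc d) (node β Y) =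
      Below d (node β Y) ⊎ (Admissible (Below d) β Y × Fresh d Y)

    -- Y ⊈ K_n^{d-2}
    Fresh : ℕ → List (Point n) → Set
    Fresh zero    Y = ⊤
    Fresh (suc d) Y = ¬ (⟦ Y ⟧ ⊆ Below d)

  private
    diagonal : {R : Point n → Point n → Set} → ∀ {Y} →
               All (λ y → R y y) Y → All (λ y → Any (R y) Y) Y
    diagonal {R} = go _ λ p → p
      where
      go : ∀ {Z} Y → (∀ {y} → Any (R y) Y → Any (R y) Z) →
           All (λ y → R y y) Y → All (λ y → Any (R y) Z) Y
      go []      f []       = []
      go (y ∷ Y) f (p ∷ ps) = f (here p) ∷ go Y (λ q → f (there q)) ps

    diagonal′ : {R : Point n → Point n → Set} → ∀ {Y} →
                All (λ y → R y y) Y → All (λ z → Any (λ y → R y z) Y) Y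
    diagonal′ {R} = diagonal {λ z y → R y z}

  mutual
    ≈-refl : ∀ w → w ≈ w
    ≈-refl (node β Y) =
      node (diagonal (≈-refl* Y)) (diagonal′ (≈-refl* Y))

    private
      ≈-refl* : ∀ Y → All (λ y → y ≈ y) Y
      ≈-refl* []      = []
      ≈-refl* (y ∷ Y) = ≈-refl y ∷ ≈-refl* Y

  mutual
    ≈-sym : ∀ {v w} → v ≈ w → w ≈ v
    ≈-sym (node p q) = node (symʳ q) (symˡ p)

    private
      symˡ : ∀ {Y Z} → All (λ y → Any (λ z → y ≈ z) Z) Y →
             All (λ y → Any (λ z → z ≈ y) Z) Y
      symˡ []       = []
      symˡ (p ∷ ps) = symˡ₁ p ∷ symˡ ps

      symˡ₁ : ∀ {y Z} → Any (λ z → y ≈ z) Z → Any (λ z → z ≈ y) Z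
      symˡ₁ (here p)  = here (≈-sym p)
      symˡ₁ (there p) = there (symˡ₁ p)

      symʳ : ∀ {Y Z} → All (λ z → Any (λ y → y ≈ z) Y) Z →
             All (λ z → Any (λ y → z ≈ y) Y) Z
      symʳ []       = []
      symʳ (p ∷ ps) = symʳ₁ p ∷ symʳ ps

      symʳ₁ : ∀ {z Y} → Any (λ y → y ≈ z) Y → Any (λ y → z ≈ y) Y
      symʳ₁ (here p)  = here (≈-sym p)
      symʳ₁ (there p) = there (symʳ₁ p)

  mutual
    ≈-trans : ∀ {u v w} → u ≈ v → v ≈ w → u ≈ w
    ≈-trans (node p q) (node p′ q′) = node (transˡ p p′) (transʳ q q′)

    private
      transˡ : ∀ {X Y Z} → All (λ x → Any (λ y → x ≈ y) Y) X →
               All (λ y → Any (λ z → y ≈ z) Z) Y →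
               All (λ x → Any (λ z → x ≈ z) Z) X
      transˡ []       r = []
      transˡ (p ∷ ps) r = transˡ₁ p r ∷ transˡ ps r

      transˡ₁ : ∀ {x Y Z} → Any (λ y → x ≈ y) Y →
                All (λ y → Any (λ z → y ≈ z) Z) Y → Any (λ z → x ≈ z) Z
      transˡ₁ (here p)  (r ∷ rs) = transˡ₂ p r
      transˡ₁ (there p) (r ∷ rs) = transˡ₁ p rs

      transˡ₂ : ∀ {x y Z} → x ≈ y → Any (λ z → y ≈ z) Z → Any (λ z → x ≈ z) Z
      transˡ₂ p (here r)  = here (≈-trans p r)
      transˡ₂ p (there r) = there (transˡ₂ p r)

      transʳ : ∀ {X Y Z} → All (λ y → Any (λ x → x ≈ y) X) Y →
               All (λ z → Any (λ y → y ≈ z) Y) Z →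
               All (λ z → Any (λ x → x ≈ z) X) Z
      transʳ q []       = []
      transʳ q (r ∷ rs) = transʳ₁ q r ∷ transʳ q rs

      transʳ₁ : ∀ {z X Y} → All (λ y → Any (λ x → x ≈ y) X) Y →
                Any (λ y → y ≈ z) Y → Any (λ x → x ≈ z) X
      transʳ₁ (q ∷ qs) (here r)  = transʳ₂ q r
      transʳ₁ (q ∷ qs) (there r) = transʳ₁ qs r

      transʳ₂ : ∀ {y z X} → Any (λ x → x ≈ y) X → y ≈ z → Any (λ x → x ≈ z) X
      transʳ₂ (here q)  r = here (≈-trans q r)
      transʳ₂ (there q) r = there (transʳ₂ q r)

  ⟦⟧-resp : ∀ {Y v w} → v ≈ w → ⟦ Y ⟧ v → ⟦ Y ⟧ w
  ⟦⟧-resp e = Any.map (≈-trans (≈-sym e))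

  strict-resp : ∀ {v w} → v ≈ w → ⟦ strict v ⟧ ⊆ ⟦ strict w ⟧
  strict-resp (node p q) u∈ = transˡ₁ u∈ p

  ≤-respʳ : ∀ {u v w} → v ≈ w → u ≤ v → u ≤ w
  ≤-respʳ e (inj₁ u∈) = inj₁ (strict-resp e u∈)
  ≤-respʳ e (inj₂ p)  = inj₂ (≈-trans p e)

  Admissible-resp : ∀ {S β Y Z} → ⟦ Y ⟧ ≐ ⟦ Z ⟧ →
                    Admissible S β Y → Admissible S β Z
  Admissible-resp (Y⊆Z , Z⊆Y) A = record
    { subset       = λ w∈ → subset (Z⊆Y w∈)
    ; decreasing   = λ Sv v≤w w∈ → Y⊆Z (decreasing Sv v≤w (Z⊆Y w∈))
    ; val-bound    = λ w∈ → val-bound (Z⊆Y w∈)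
    ; val-distinct = λ Sw (p , q) →
        val-distinct Sw ((λ v∈ → p (Y⊆Z v∈)) , λ v∈ → Z⊆Y (q v∈))
    }
    where open Admissible A

  Below-resp : ∀ d {v w} → v ≈ w → Below d v → Below d w
  Below-resp (suc d) e@(node _ _) (inj₁ b)       = inj₁ (Below-resp d e b)
  Below-resp (suc d) e@(node {Y = Y} {Z = Z} _ _) (inj₂ (A , f)) =
    inj₂ (Admissible-resp (strict-resp e , strict-resp (≈-sym e)) A , fresh d f)
    where
    fresh : ∀ d → Fresh d Y → Fresh d Z
    fresh zero    _ = tt
    fresh (suc d) f Z⊆ = f λ w∈ → Z⊆ (strict-resp e w∈)

  Below-down : ∀ d {v w} → v ≤ w → Below d w → Below d v
  Below-down d       {w = w}        (inj₂ e)  b              = Below-resp d (≈-sym e) b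
  Below-down (suc d) {w = node _ _} (inj₁ v∈) (inj₁ b)       = up (Below-down d (inj₁ v∈) b)
    where
    up : ∀ {v} → Below d v → Below (suc d) v
    up {node _ _} = inj₁
  Below-down (suc d) {v = node _ _} {w = node _ _} (inj₁ v∈) (inj₂ (A , _)) =
    inj₁ (Admissible.subset A v∈)

  ≤-trans-Below : ∀ d {u v w} → Below d w → u ≤ v → v ≤ w → u ≤ w
  ≤-trans-Below d b p (inj₂ e) = ≤-respʳ e p
  ≤-trans-Below (suc d) {w = node _ _} (inj₁ b) p q@(inj₁ _) =
    ≤-trans-Below d b p q
  ≤-trans-Below (suc d) {w = node _ _} (inj₂ (A , _)) p (inj₁ v∈) =
    inj₁ (decreasing (Below-down d p (subset v∈)) p v∈)
    where open Admissible A

  mutual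
    strict-asym : ∀ v {u} → ⟦ strict v ⟧ u → ⟦ strict u ⟧ v → ⊥
    strict-asym (node β Y) u∈v v∈u = strict-asym* Y u∈v u∈v v∈u

    private
      strict-asym* : ∀ {u v} Y → ⟦ Y ⟧ u →
                     ⟦ strict v ⟧ u → ⟦ strict u ⟧ v → ⊥
      strict-asym* {v = v} (y ∷ Y) (here e)  u∈v v∈u =
        strict-asym y (strict-resp e v∈u) (⟦⟧-resp {strict v} e u∈v)
      strict-asym* {v = v} (y ∷ Y) (there p) u∈v v∈u =
        strict-asym* {v = v} Y p u∈v v∈u

  ≤-antisym : ∀ {v w} → v ≤ w → w ≤ v → v ≈ w
  ≤-antisym (inj₂ e) _        = e
  ≤-antisym (inj₁ _) (inj₂ e) = ≈-sym e
  ≤-antisym {w = w} (inj₁ p) (inj₁ q) = ⊥-elim (strict-asym w p q)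

K : ℕ → Poset 0ℓ 0ℓ 0ℓ
K n = record
  { Carrier        = Σ (Point n) (λ w → ∃ λ d → Below d w)
  ; _≈_            = λ v w → proj₁ v ≈ proj₁ w
  ; _≤_            = λ v w → proj₁ v ≤ proj₁ w
  ; isPartialOrder = record
    { isPreorder = record
      { isEquivalence = record
        { refl = ≈-refl _ ; sym = ≈-sym ; trans = ≈-trans }
      ; reflexive = inj₂
      ; trans     = λ { {k = _ , d , b} p q → ≤-trans-Below d b p q }
      }
    ; antisym = ≤-antisym
    }
  }

-- K_n^d for d ≥ 0.
K^ : ∀ {n} → ℕ → Pred (Poset.Carrier (K n)) 0ℓ
K^ d (w , _) = Below (suc d) w

module _ (P : Poset 0ℓ 0ℓ 0ℓ) where
  private module P = Poset P

  record DownSet : Set₁ where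
    field
      elements : Pred P.Carrier 0ℓ
      down     : ∀ {v w} → v P.≤ w → elements w → elements v

  -- As usual for filtering (directed) sets, the empty set is excluded.
  UpwardFiltering : Pred P.Carrier 0ℓ → Set
  UpwardFiltering X =
    ∃ X × (∀ {w₀ w₁} → X w₀ → X w₁ → ∃ λ w → X w × w₀ P.≤ w × w₁ P.≤ w)

module _ {P : Poset 0ℓ 0ℓ 0ℓ} where
  private module P = Poset P
  open DownSet

  interior : Pred P.Carrier 0ℓ → DownSet P
  interior S = record
    { elements = λ w → ∀ {v} → v P.≤ w → S v
    ; down     = λ v≤w f u≤v → f (P.trans u≤v v≤w)
    }

  interior-⊆ : ∀ S → elements (interior S) ⊆ S
  interior-⊆ S f = f P.refl

  interior-largest : ∀ S (c : DownSet P) → elements c ⊆ S →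
                     elements c ⊆ elements (interior S)
  interior-largest S c c⊆S w∈ v≤w = c⊆S (down c v≤w w∈)

𝓞↓ : ExcludedMiddle 0ℓ → Poset 0ℓ 0ℓ 0ℓ → HeytingAlgebra (lsuc 0ℓ) 0ℓ 0ℓ
𝓞↓ em P = record
  { Carrier = DownSet P
  ; _≈_     = λ a b → elements a ≐ elements b
  ; _≤_     = λ a b → elements a ⊆ elements b
  ; _∨_     = λ a b → record
    { elements = elements a ∪ elements b
    ; down     = λ p → λ { (inj₁ x) → inj₁ (down a p x)
                         ; (inj₂ x) → inj₂ (down b p x) } }
  ; _∧_     = λ a b → record
    { elements = elements a ∩ elements b
    ; down     = λ p (x , y) → down a p x , down b p y }
  ; _⇨_     = λ a b → interior (∁ (elements a) ∪ elements b)
  ; ⊤       = record { elements = U ; down = λ _ _ → tt }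
  ; ⊥       = record { elements = ∅ ; down = λ _ () }
  ; isHeytingAlgebra = record
    { isBoundedLattice = record
      { isLattice = record
        { isPartialOrder = record
          { isPreorder = record
            { isEquivalence = record
              { refl  = (λ x → x) , (λ x → x)
              ; sym   = λ (p , q) → q , p
              ; trans = λ (p , q) (p′ , q′) → (λ x → p′ (p x)) , (λ x → q (q′ x)) }
            ; reflexive = proj₁
            ; trans     = λ p q x → q (p x) }
          ; antisym = λ p q → p , q }
        ; supremum = λ a b → inj₁ , inj₂ , λ c p q → [ p , q ]′
        ; infimum  = λ a b → proj₁ , proj₂ , λ c p q x → p x , q x }
      ; maximum = λ _ _ → tt
      ; minimum = λ _ () }
    ; exponential = λ c a b →
        (λ p → interior-largest (∁ (elements a) ∪ elements b) c (λ x → curry a b p x))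
      , (λ p (x , y) → [ (λ y∉ → ⊥-elim (y∉ y)) , (λ z → z) ]′ (p x (Poset.refl P)))
    }
  }
  where
  open DownSet
  curry : ∀ (a b : DownSet P) {C : Pred (Poset.Carrier P) 0ℓ} →
          C ∩ elements a ⊆ elements b → C ⊆ ∁ (elements a) ∪ elements b
  curry a b p {w} x with em {elements a w}
  ... | yes y = inj₂ (p (x , y))
  ... | no y∉ = inj₁ y∉

record HeytingSubalgebra {c ℓ₁ ℓ₂} (A : HeytingAlgebra c ℓ₁ ℓ₂) (ℓ : Level)
       : Set (c ⊔ ℓ₁ ⊔ lsuc ℓ) where
  private module A = HeytingAlgebra A
  field
    member : Pred A.Carrier ℓ
    resp   : ∀ {a b} → a A.≈ b → member a → member b
    ⊤∈     : member A.⊤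
    ⊥∈     : member A.⊥
    ∨∈     : ∀ {a b} → member a → member b → member (a A.∨ b)
    ∧∈     : ∀ {a b} → member a → member b → member (a A.∧ b)
    ⇨∈     : ∀ {a b} → member a → member b → member (a A.⇨ b)

  heytingAlgebra : HeytingAlgebra (c ⊔ ℓ) ℓ₁ ℓ₂
  heytingAlgebra = record
    { Carrier = Σ A.Carrier member
    ; _≈_     = λ a b → proj₁ a A.≈ proj₁ b
    ; _≤_     = λ a b → proj₁ a A.≤ proj₁ b
    ; _∨_     = λ (a , p) (b , q) → a A.∨ b , ∨∈ p q
    ; _∧_     = λ (a , p) (b , q) → a A.∧ b , ∧∈ p q
    ; _⇨_     = λ (a , p) (b , q) → a A.⇨ b , ⇨∈ p q
    ; ⊤       = A.⊤ , ⊤∈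
    ; ⊥       = A.⊥ , ⊥∈
    ; isHeytingAlgebra = record
      { isBoundedLattice = record
        { isLattice = record
          { isPartialOrder = record
            { isPreorder = record
              { isEquivalence = record
                { refl = A.Eq.refl ; sym = A.Eq.sym ; trans = A.Eq.trans }
              ; reflexive = A.reflexive
              ; trans     = A.trans }
            ; antisym = A.antisym }
          ; supremum = λ (a , _) (b , _) →
              A.x≤x∨y a b , A.y≤x∨y a b , λ _ → A.∨-least
          ; infimum  = λ (a , _) (b , _) →
              A.x∧y≤x a b , A.x∧y≤y a b , λ _ → A.∧-greatest }
        ; maximum = λ (a , _) → A.maximum a
        ; minimum = λ (a , _) → A.minimum a }
      ; exponential = λ (a , _) (b , _) (c , _) → A.exponential a b c
      }
    }

⊔-Irreducible : ∀ {c ℓ₁ ℓ₂} (L : BoundedLattice c ℓ₁ ℓ₂) →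
                BoundedLattice.Carrier L → Set (c ⊔ ℓ₁)
⊔-Irreducible L a =
  ¬ (a ≈ᴸ ⊥ᴸ) ×
  ¬ (∃₂ λ b₁ b₂ → a ≈ᴸ (b₁ ∨ b₂) × ¬ (b₁ ≈ᴸ a) × ¬ (b₂ ≈ᴸ a))
  where open BoundedLattice L renaming (_≈_ to _≈ᴸ_; ⊥ to ⊥ᴸ)

F̂ : ExcludedMiddle 0ℓ → ℕ → HeytingAlgebra (lsuc 0ℓ) 0ℓ 0ℓ
F̂ em n = 𝓞↓ em (K n)

IsMin : Pred ℕ 0ℓ → Pred ℕ 0ℓ
IsMin S i = S i × (∀ {j} → S j → i ℕ.≤ j)

Differ : ∀ {n} → DownSet (K n) → DownSet (K n) → Pred ℕ 0ℓ
Differ a b i = ¬ ((elements a ∩ K^ i) ≐ (elements b ∩ K^ i))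
  where open DownSet

2^-_ : ℕ → ℚ
2^- i = (+ 1 / (2 ℕ.^ i)) {{m^n≢0 2 i}}

-- Classically, a set of naturals without a minimum is empty; hence the
-- value 0 = 2^{-min ∅} in the second case.
distance : ExcludedMiddle 0ℓ → ∀ {n} → DownSet (K n) → DownSet (K n) → ℚ
distance em a b = case (em {∃ (IsMin (Differ a b))})
  where
  case : Dec (∃ (IsMin (Differ a b))) → ℚ
  case (yes (i , _)) = 2^- i
  case (no _)        = 0ℚ

-- All values of the metric are rational, so rational radii suffice.
Dense : (em : ExcludedMiddle 0ℓ) → ∀ {n ℓ} →
        HeytingSubalgebra (F̂ em n) ℓ → Set (lsuc 0ℓ ⊔ ℓ)
Dense em H =
  ∀ a {ε} → 0ℚ ℚ.< ε → ∃ λ h → HeytingSubalgebra.member H h × distance em a h ℚ.< ε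

{-# OPTIONS --safe #-}
-- A decreasing set containing no point of rank d + 1 contains no point of
-- larger rank either, because a point of rank r > 0 has a point of rank r - 1
-- below it.  Hence a decreasing subset A of K_n^d is isolated for the metric,
-- and belongs to every dense subalgebra H.  In particular H contains ↓w and
-- ↓w ∖ {w} for every point w, and with them ↓w → (↓w ∖ {w}) = { v ∣ v ≱ w }.
-- If w₀ and w₁ have no upper bound in X, then X is the union of its proper
-- subsets X ∩ { v ∣ v ≱ w₀ } and X ∩ { v ∣ v ≱ w₁ }, which lie in H.
module Submission where

open import Defs
open import Axiom.DoubleNegationElimination using (em⇒dne)
open import Axiom.ExcludedMiddle using (ExcludedMiddle)
open import Data.Empty using (⊥-elim)
open import Data.Integer.Base using (+_; +≤+)
import Data.Integer.Properties as ℤ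
open import Data.Nat.Base as ℕ using (ℕ; zero; suc)
open import Data.Nat.Induction using (<-rec)
import Data.Nat.Properties as ℕ
open import Data.Product.Base using (∃; _×_; _,_; proj₁; proj₂)
open import Data.Rational.Base as ℚ using (0ℚ; _/_)
import Data.Rational.Properties as ℚ
open import Data.Rational.Unnormalised.Base using (mkℚᵘ; *≤*)
import Data.Rational.Unnormalised.Properties as ℚᵘ
open import Data.Sum.Base using (inj₁; inj₂; [_,_]′)
open import Function.Bundles using (_⇔_; mk⇔)
open import Level using (Level; 0ℓ)
open import Relation.Binary.Bundles using (Poset)
open import Relation.Binary.Lattice.Bundles using (HeytingAlgebra)
open import Relation.Binary.PropositionalEquality.Core using (refl)
open import Relation.Nullary using (¬_; yes; no)
open import Relation.Unary using (Pred; _⊆_; _≐_; _∩_)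

open DownSet

-- Since `_/_` reduces fractions, the comparison is made between unnormalised rationals, where it is
-- cross-multiplication.
1/-antimono-≤ : ∀ m n .{{_ : ℕ.NonZero m}} .{{_ : ℕ.NonZero n}} →
                m ℕ.≤ n → + 1 / n ℚ.≤ + 1 / m
1/-antimono-≤ (suc m) (suc n) m≤n = ℚ.toℚᵘ-cancel-≤ (begin
  ℚ.toℚᵘ (ℚ.fromℚᵘ (mkℚᵘ (+ 1) n)) ≃⟨ ℚ.toℚᵘ-fromℚᵘ (mkℚᵘ (+ 1) n) ⟩
  mkℚᵘ (+ 1) n                     ≤⟨ *≤* (ℤ.*-monoˡ-≤-nonNeg (+ 1) (+≤+ m≤n)) ⟩
  mkℚᵘ (+ 1) m                     ≃⟨ ℚ.toℚᵘ-fromℚᵘ (mkℚᵘ (+ 1) m) ⟨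
  ℚ.toℚᵘ (ℚ.fromℚᵘ (mkℚᵘ (+ 1) m)) ∎)
  where open ℚᵘ.≤-Reasoning

2^-‿antimono-≤ : ∀ {i j} → i ℕ.≤ j → 2^- j ℚ.≤ 2^- i
2^-‿antimono-≤ {i} {j} i≤j =
  1/-antimono-≤ (2 ℕ.^ i) (2 ℕ.^ j) {{ℕ.m^n≢0 2 i}} {{ℕ.m^n≢0 2 j}}
    (ℕ.^-monoʳ-≤ 2 i≤j)

0<2^- : ∀ i → 0ℚ ℚ.< 2^- i
0<2^- i = ℚ.positive⁻¹ (2^- i)
  {{ℚ.normalize-pos 1 (2 ℕ.^ i) {{ℕ.m^n≢0 2 i}}}}

module _ {n : ℕ} where

  Below-suc : ∀ d {w : Point n} → Below d w → Below (suc d) w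
  Below-suc d {node _ _} = inj₁

  Below-mono : ∀ {d e} {w : Point n} → d ℕ.≤ e → Below d w → Below e w
  Below-mono {d} {e} {w} d≤e = go (ℕ.≤⇒≤′ d≤e)
    where
    go : ∀ {e} → d ℕ.≤′ e → Below d w → Below e w
    go ℕ.≤′-refl       b = b
    go (ℕ.≤′-step d≤e) b = Below-suc _ (go d≤e b)

  module _ {S : Pred (Point n) 0ℓ} (k : ℕ)
           (S-down : ∀ {v w} → v ≤ w → S w → S v)
           (S-gap : ∀ {w} → S w → Below (suc k) w → Below k w) where

    -- By induction on `d`: a point of `S` of rank above `k` would have all of `Y` inside `Below k`,
    -- against `Fresh`.
    gap⇒bounded : ∀ d {w} → Below d w → S w → Below k w
    gap⇒bounded (suc d) {node β Y} (inj₁ b)       Sw = gap⇒bounded d b Sw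
    gap⇒bounded (suc d) {node β Y} b@(inj₂ (A , f)) Sw with ℕ.≤-<-connex d k
    ... | inj₁ d≤k = S-gap Sw (Below-mono (ℕ.s≤s d≤k) b)
    gap⇒bounded (suc (suc d)) {node β Y} (inj₂ (A , f)) Sw | inj₂ (ℕ.s≤s k≤d) =
      ⊥-elim (f λ v∈ → Below-mono k≤d
        (gap⇒bounded (suc d) (Admissible.subset A v∈) (S-down (inj₁ v∈) Sw)))

  -- The membership proof is quantified because elements h may a priori
  -- distinguish the different proofs that w is a point.
  DownSet-gap : ∀ (h : DownSet (K n)) k →
                (∀ {w} → elements h w → Below (suc k) (proj₁ w) → Below k (proj₁ w)) →
                ∀ {w} → elements h w → Below k (proj₁ w)
  DownSet-gap h k gap {w , d , b} hw =
    gap⇒bounded {S = λ v → ∃ λ p → elements h (v , p)} k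
      (λ { v≤w ((e , c) , hw) → (e , Below-down e v≤w c) , down h v≤w hw })
      (λ (_ , hw) → gap hw) d b ((d , b) , hw)

  module _ (em : ExcludedMiddle 0ℓ) (a b : DownSet (K n)) where

    differ-min : ∀ i → Differ a b i → ∃ (IsMin (Differ a b))
    differ-min i i∈ = em⇒dne em λ ∄min →
      -- Least number principle: without a minimum, strong induction rules out every index.
      <-rec (λ j → ¬ Differ a b j)
        (λ j rec j∈ → ∄min (j , j∈ , λ {k} k∈ → ℕ.≮⇒≥ λ k<j → rec k<j k∈))
        i i∈

    distance<⇒agree : ∀ i → distance em a b ℚ.< 2^- i →
                      (elements a ∩ K^ i) ≐ (elements b ∩ K^ i)
    distance<⇒agree i d< with em {∃ (IsMin (Differ a b))}
    -- A difference at `i` would force `m ≤ i`, making the distance `2^- m` at least `2^- i`.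
    ... | yes (m , _ , min) = em⇒dne em λ i∈ →
            ℚ.<-irrefl refl (ℚ.<-≤-trans d< (2^-‿antimono-≤ (min i∈)))
    ... | no ∄min           = em⇒dne em λ i∈ → ∄min (differ-min i i∈)

  module _ (em : ExcludedMiddle 0ℓ) {ℓ} (H : HeytingSubalgebra (F̂ em n) ℓ)
           (dense : Dense em H) where
    open HeytingSubalgebra H

    bounded⇒member : ∀ d (a : DownSet (K n)) → elements a ⊆ K^ d → member a
    -- The radius reaches one level past `K^ d`: agreement there shows that `h` has no point of rank
    -- `d + 1`, so `DownSet-gap` confines `h` to `K^ d`.
    bounded⇒member d a a⊆ with dense a (0<2^- (suc d))
    ... | h , h∈ , dist< with distance<⇒agree em a h (suc d) dist<
    ...   | a⊆h , h⊆a = resp (h⇒a , a⇒h) h∈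
      where
      h⊆K^d : elements h ⊆ K^ d
      h⊆K^d = DownSet-gap h (suc d) λ hw b → a⊆ (proj₁ (h⊆a (hw , b)))

      h⇒a : elements h ⊆ elements a
      h⇒a {w , _} hw = proj₁ (h⊆a (hw , Below-suc (suc d) {w} (h⊆K^d hw)))

      a⇒h : elements a ⊆ elements h
      a⇒h {w , _} aw = proj₁ (a⊆h (aw , Below-suc (suc d) {w} (a⊆ aw)))

module _ (P : Poset 0ℓ 0ℓ 0ℓ) where
  private module P = Poset P

  ↓ : P.Carrier → DownSet P
  ↓ w = record { elements = P._≤ w ; down = P.trans }

  -- Given `v ≤ w`, the condition `¬ (w ≤ v)` amounts to `v ≉ w`; in this form it passes to smaller
  -- points by transitivity.
  ↓° : P.Carrier → DownSet P
  ↓° w = record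
    { elements = λ v → v P.≤ w × ¬ (w P.≤ v)
    ; down     = λ u≤v (v≤w , w≰v) →
        P.trans u≤v v≤w , λ w≤u → w≰v (P.trans w≤u u≤v)
    }

  module _ (em : ExcludedMiddle 0ℓ) where
    open HeytingAlgebra (𝓞↓ em P) using (_⇨_)

    -- The complement of `↓ w` together with `↓° w` is everything except `w`, so its interior
    -- consists of the points that do not have `w` below them.
    ≱⇒∈↓⇨↓° : ∀ {v w} → ¬ (w P.≤ v) → elements (↓ w ⇨ ↓° w) v
    ≱⇒∈↓⇨↓° {w = w} w≰v {u} u≤v with em {u P.≤ w}
    ... | yes u≤w = inj₂ (u≤w , λ w≤u → w≰v (P.trans w≤u u≤v))
    ... | no u≰w  = inj₁ u≰w

    ∈↓⇨↓°⇒≱ : ∀ {v w} → elements (↓ w ⇨ ↓° w) v → ¬ (w P.≤ v)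
    ∈↓⇨↓°⇒≱ f w≤v with f w≤v
    ... | inj₁ w≰w       = w≰w P.refl
    ... | inj₂ (_ , w≰w) = w≰w P.refl

module _ (em : ExcludedMiddle 0ℓ) (n : ℕ) {ℓ} (H : HeytingSubalgebra (F̂ em n) ℓ)
         where
  open HeytingSubalgebra H
  open HeytingAlgebra heytingAlgebra using (Carrier; boundedLattice)
  private
    module K = Poset (K n)
    module F = HeytingAlgebra (F̂ em n)

  -- If `a` misses `u` and `b` misses `v`, an upper bound `z` of both in `X` lies in `a` or `b`,
  -- which then contains `u` or `v` respectively.
  filtering⇒irreducible : (X : Carrier) → UpwardFiltering (K n) (elements (proj₁ X)) →
                          ⊔-Irreducible boundedLattice X
  filtering⇒irreducible (X , _) ((w , Xw) , directed) =
    (λ (X⊆∅ , _) → X⊆∅ Xw) , λ where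
      ((a , _) , (b , _) , (X⊆ , ⊆X) , a≉X , b≉X) →
        a≉X ((λ aw → ⊆X (inj₁ aw)) , λ {u} Xu → em⇒dne em λ ¬au →
        b≉X ((λ bw → ⊆X (inj₂ bw)) , λ {v} Xv → em⇒dne em λ ¬bv →
        let (z , Xz , u≤z , v≤z) = directed Xu Xv in
        [ (λ az → ¬au (down a u≤z az)) , (λ bz → ¬bv (down b v≤z bz)) ]′ (X⊆ Xz)))

  module _ (dense : Dense em H) where

    ↓⇨↓°-member : ∀ w → member (↓ (K n) w F.⇨ ↓° (K n) w)
    ↓⇨↓°-member w@(_ , d , b) = ⇨∈
      (bounded⇒member em H dense d (↓ (K n) w) λ {v} → below {v})
      (bounded⇒member em H dense d (↓° (K n) w) λ {v} (v≤w , _) → below {v} v≤w)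
      where
      below : ∀ {v} → v K.≤ w → K^ d v
      -- `Below d` is one level lower than `K^ d`, hence the weakening.
      below {v , _} v≤w = Below-suc d {v} (Below-down d v≤w b)

    irreducible⇒filtering : (X : Carrier) → ⊔-Irreducible boundedLattice X →
                            UpwardFiltering (K n) (elements (proj₁ X))
    irreducible⇒filtering (X , X∈) (X≉⊥ , indecomposable) = nonempty , directed
      where
      nonempty : ∃ (elements X)
      nonempty = em⇒dne em λ empty → X≉⊥ ((λ {w} Xw → empty (w , Xw)) , λ ())

      directed : ∀ {w₀ w₁} → elements X w₀ → elements X w₁ →
                 ∃ λ w → elements X w × w₀ K.≤ w × w₁ K.≤ w
      directed {w₀} {w₁} Xw₀ Xw₁ = em⇒dne em λ unbounded → indecomposable
        ( part w₀ , part w₁ , (cover unbounded , λ { (inj₁ (Xv , _)) → Xv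
                                                   ; (inj₂ (Xv , _)) → Xv })
        , proper Xw₀ , proper Xw₁ )
        where
        part : K.Carrier → Carrier
        part w = X F.∧ (↓ (K n) w F.⇨ ↓° (K n) w) , ∧∈ X∈ (↓⇨↓°-member w)

        proper : ∀ {w} → elements X w → ¬ (proj₁ (part w) F.≈ X)
        proper {w} Xw (_ , X⊆) =
          -- The point `w` of `X` is itself missing from `part w`.
          ∈↓⇨↓°⇒≱ (K n) em {w} {w} (λ {u} → proj₂ (X⊆ {w} Xw) {u}) (K.refl {w})

        cover : ¬ (∃ λ w → elements X w × w₀ K.≤ w × w₁ K.≤ w) →
                elements X ⊆ elements (proj₁ (part w₀) F.∨ proj₁ (part w₁))
        cover unbounded {v} Xv with em {w₀ K.≤ v}
        -- A point of `X` above both `w₀` and `w₁` is excluded, so each `v` avoids one of them and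
        -- falls into that part.
        ... | no w₀≰v  = inj₁ (Xv , λ {u} → ≱⇒∈↓⇨↓° (K n) em {v} {w₀} w₀≰v {u})
        ... | yes w₀≤v = inj₂ (Xv , λ {u} → ≱⇒∈↓⇨↓° (K n) em {v} {w₁}
                (λ w₁≤v → unbounded (v , Xv , w₀≤v , w₁≤v)) {u})

proposition7p1 : (em : ExcludedMiddle 0ℓ) (n : ℕ) → 1 ℕ.≤ n →
    {ℓ : Level} (H : HeytingSubalgebra (F̂ em n) ℓ) → Dense em H →
    (X : HeytingAlgebra.Carrier (HeytingSubalgebra.heytingAlgebra H)) →
    ⊔-Irreducible (HeytingAlgebra.boundedLattice (HeytingSubalgebra.heytingAlgebra H)) X
    ⇔ UpwardFiltering (K n) (DownSet.elements (proj₁ X))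
proposition7p1 em n _ H dense X =
  mk⇔ (irreducible⇒filtering em n H dense X) (filtering⇒irreducible em n H X)
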